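{- Let $M$ be a simple typed term. If $M$ has a head redex, then $M\in SN$ if and only if $arg(M)\subseteq SN$ and $hred(M)\in SN$. Otherwise, $M\in SN$ if and only if $arg(M)\subseteq SN$.
   Context: Formulas: atoms, $\perp$, $\rightarrow,\wedge,\vee$; $\neg A=A\rightarrow\perp$. Intuitionistic variables $x,y,\dots$, classical variables $a,b,\dots$. Terms: ${\cal T} ::= x \mid \lambda x\, {\cal T} \mid ({\cal T}\ {\cal E}) \mid \langle {\cal T},{\cal T}\rangle \mid \omega_1 {\cal T} \mid \omega_2 {\cal T} \mid \mu a\, {\cal T} \mid (a\ {\cal T})$, ${\cal E} ::= {\cal T} \mid \pi_1 \mid \pi_2 \mid [x.{\cal T}, y.{\cal T}]$; $(M\ N_1\dots N_n)=((M\ N_1)\dots N_n)$. Typing (contexts contain $x:A$, $a:\neg A$): $x:A$ for declared $x$; $\langle M,N\rangle:A\wedge B$ from $M:A,N:B$; $(M\ \pi_i):A_i$ from $M:A_1\wedge A_2$; $\lambda xM:A\rightarrow B$ from $M:B$ under $x:A$; $(M\ N):B$ from $M:A\rightarrow B,N:A$; $\omega_iM:A_1\vee A_2$ from $M:A_i$; $(M\ [x_1.N_1,x_2.N_2]):C$ from $M:A_1\vee A_2$ and $N_i:C$ under $x_i:A_i$; $\mu aM:A$ from $M:\perp$ under $a:\neg A$; $(a\ M):\perp$ from $M:A$ under $a:\neg A$. Typed = has a type in some context. Reduction $\triangleright$: compatible closure (including inside branches of $[x.N_1,y.N_2]$) of $(\lambda x M\ N)\triangleright M[x:=N]$; $(\langle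 M_1,M_2\rangle\ \pi_i)\triangleright M_i$; $(\omega_i M\ [x_1.N_1,x_2.N_2])\triangleright N_i[x_i:=M]$; $(M\ [x_1.N_1,x_2.N_2]\ \varepsilon)\triangleright (M\ [x_1.(N_1\ \varepsilon),x_2.(N_2\ \varepsilon)])$; $(\mu a M\ \varepsilon)\triangleright \mu a\, M[a:=^*\varepsilon]$ ($M[a:=^*\varepsilon]$ replaces each subterm $(a\ N)$ by $(a\ (N\ \varepsilon))$). An element of ${\cal E}$ is in $SN$ if it has no infinite reduction sequence (so $[y_1.N_1,y_2.N_2]\in SN$ iff $N_1,N_2\in SN$). A term is simple if it is a variable or an application. A sequence $N_1,\dots,N_n$ of elements of ${\cal E}$ is nice if each $N_i\in{\cal T}\cup\{\pi_1,\pi_2\}$ except possibly $N_n$. Every simple typed term $M$ is uniquely of one of the following forms, with $\overline{T}=T_1,\dots,T_n$ nice and, in (4),(5), $\varepsilon\ \overline{T}$ nice; the head $hd(M)$ and arguments $arg(M)$ are: (0) $M=(x\ \overline{T})$ or $(a\ T)$: $hd(M)=x$ (resp. $a$), $arg(M)=\{T_1,\dots,T_n\}$ (resp. $\{T\}$); (1) $M=(\lambda xN\ O\ \overline{T})$: $hd=(\lambda xN\ O)$, $arg=\{O\}$; (2) $M=(\langle N_1,N_2\rangle\ \pi_i\ \overline{T})$: $hd=(\langle N_1,N_2\rangle\ \pi_i)$, $arg=\{N_1,N_2\}$; (3) $M=(\omega_iN\ [x_1.O_1,x_2.O_2])$: $hd=M$, $arg=\{N,O_1,O_2\}$; (4)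 $M=(\mu aN\ \varepsilon\ \overline{T})$: $hd=(\mu aN\ \varepsilon)$, $arg=\{\varepsilon\}$; (5) $M=(N\ [x_1.O_1,x_2.O_2]\ \varepsilon\ \overline{T})$: $hd=(N\ [x_1.O_1,x_2.O_2]\ \varepsilon)$, $arg=\emptyset$. In cases (1)–(5) $M$ has a head redex, namely $hd(M)$; in case (0) it has none. The head reduct $hred(M)$ is the term obtained from $M$ by reducing its head redex (by the corresponding reduction rule above). -}

module Defs where

open import Data.Nat using (ℕ; zero; suc; _≟_)
open import Data.List using (List; []; _∷_)
open import Data.List.Relation.Unary.All using (All)
open import Data.Maybe using (Maybe; just; nothing)
open import Data.Product using (Σ; ∃; _×_)
open import Relation.Nullary using (yes; no)
open import Induction.WellFounded using (Acc)

data Form : Set where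
  atom : ℕ → Form
  ⊥'   : Form
  _⇒_  : Form → Form → Form
  _∧'_ : Form → Form → Form
  _∨'_ : Form → Form → Form

¬' : Form → Form
¬' A = A ⇒ ⊥'

-- Terms (de Bruijn).  Two independent index spaces: intuitionistic
-- variables (bound by lam and by the two branches of a case) and
-- classical variables (bound by mu).

mutual
  data Tm : Set where
    var  : ℕ → Tm
    lam  : Tm → Tm
    app  : Tm → El → Tm
    pair : Tm → Tm → Tm
    ω₁   : Tm → Tm
    ω₂   : Tm → Tm
    mu   : Tm → Tm
    capp : ℕ → Tm → Tm

  data El : Set where
    tm   : Tm → El
    π₁   : El
    π₂   : El
    case : Tm → Tm → El      -- [x.T , y.T]  (each branch binds one intuitionistic var)

ext : (ℕ → ℕ) → ℕ → ℕ
ext ρ zero    = zero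
ext ρ (suc n) = suc (ρ n)

mutual
  renI : (ℕ → ℕ) → Tm → Tm
  renI ρ (var x)    = var (ρ x)
  renI ρ (lam M)    = lam (renI (ext ρ) M)
  renI ρ (app M e)  = app (renI ρ M) (renIE ρ e)
  renI ρ (pair M N) = pair (renI ρ M) (renI ρ N)
  renI ρ (ω₁ M)     = ω₁ (renI ρ M)
  renI ρ (ω₂ M)     = ω₂ (renI ρ M)
  renI ρ (mu M)     = mu (renI ρ M)
  renI ρ (capp a M) = capp a (renI ρ M)

  renIE : (ℕ → ℕ) → El → El
  renIE ρ (tm M)       = tm (renI ρ M)
  renIE ρ π₁           = π₁
  renIE ρ π₂           = π₂
  renIE ρ (case N₁ N₂) = case (renI (ext ρ) N₁) (renI (ext ρ) N₂)

mutual
  renC : (ℕ → ℕ) → Tm → Tm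
  renC ρ (var x)    = var x
  renC ρ (lam M)    = lam (renC ρ M)
  renC ρ (app M e)  = app (renC ρ M) (renCE ρ e)
  renC ρ (pair M N) = pair (renC ρ M) (renC ρ N)
  renC ρ (ω₁ M)     = ω₁ (renC ρ M)
  renC ρ (ω₂ M)     = ω₂ (renC ρ M)
  renC ρ (mu M)     = mu (renC (ext ρ) M)
  renC ρ (capp a M) = capp (ρ a) (renC ρ M)

  renCE : (ℕ → ℕ) → El → El
  renCE ρ (tm M)       = tm (renC ρ M)
  renCE ρ π₁           = π₁
  renCE ρ π₂           = π₂
  renCE ρ (case N₁ N₂) = case (renC ρ N₁) (renC ρ N₂)

extsI : (ℕ → Tm) → ℕ → Tm
extsI σ zero    = var zero
extsI σ (suc n) = renI suc (σ n)

extsC : (ℕ → Tm) → ℕ → Tm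
extsC σ n = renC suc (σ n)

mutual
  subI : (ℕ → Tm) → Tm → Tm
  subI σ (var x)    = σ x
  subI σ (lam M)    = lam (subI (extsI σ) M)
  subI σ (app M e)  = app (subI σ M) (subIE σ e)
  subI σ (pair M N) = pair (subI σ M) (subI σ N)
  subI σ (ω₁ M)     = ω₁ (subI σ M)
  subI σ (ω₂ M)     = ω₂ (subI σ M)
  subI σ (mu M)     = mu (subI (extsC σ) M)
  subI σ (capp a M) = capp a (subI σ M)

  subIE : (ℕ → Tm) → El → El
  subIE σ (tm M)       = tm (subI σ M)
  subIE σ π₁           = π₁
  subIE σ π₂           = π₂
  subIE σ (case N₁ N₂) = case (subI (extsI σ) N₁) (subI (extsI σ) N₂)

single : Tm → ℕ → Tm
single N zero    = N
single N (suc n) = var n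

_[0:=_] : Tm → Tm → Tm
M [0:= N ] = subI (single N) M

mutual
  msub : ℕ → El → Tm → Tm
  msub a ε (var x)    = var x
  msub a ε (lam M)    = lam (msub a (renIE suc ε) M)
  msub a ε (app M e)  = app (msub a ε M) (msubE a ε e)
  msub a ε (pair M N) = pair (msub a ε M) (msub a ε N)
  msub a ε (ω₁ M)     = ω₁ (msub a ε M)
  msub a ε (ω₂ M)     = ω₂ (msub a ε M)
  msub a ε (mu M)     = mu (msub (suc a) (renCE suc ε) M)
  msub a ε (capp b M) with b ≟ a
  ... | yes _ = capp b (app (msub a ε M) ε)
  ... | no  _ = capp b (msub a ε M)

  msubE : ℕ → El → El → El
  msubE a ε (tm M)       = tm (msub a ε M)
  msubE a ε π₁           = π₁
  msubE a ε π₂           = π₂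
  msubE a ε (case N₁ N₂) = case (msub a (renIE suc ε) N₁) (msub a (renIE suc ε) N₂)

-- (μa M ε) reduces to μa M[a:=* ε]; a is index 0 inside M, so ε is
-- shifted over the classical binder.
muRed : Tm → El → Tm
muRed M ε = mu (msub zero (renCE suc ε) M)

-- (M [x₁.N₁,x₂.N₂] ε) reduces to (M [x₁.(N₁ ε), x₂.(N₂ ε)]); ε is shifted
-- over the intuitionistic binder of each branch.
permRed : Tm → Tm → Tm → El → Tm
permRed M N₁ N₂ ε = app M (case (app N₁ (renIE suc ε)) (app N₂ (renIE suc ε)))

mutual
  data _▷_ : Tm → Tm → Set where
    β     : ∀ {M N} → app (lam M) (tm N) ▷ (M [0:= N ])
    π₁β   : ∀ {M₁ M₂} → app (pair M₁ M₂) π₁ ▷ M₁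
    π₂β   : ∀ {M₁ M₂} → app (pair M₁ M₂) π₂ ▷ M₂
    ω₁β   : ∀ {M N₁ N₂} → app (ω₁ M) (case N₁ N₂) ▷ (N₁ [0:= M ])
    ω₂β   : ∀ {M N₁ N₂} → app (ω₂ M) (case N₁ N₂) ▷ (N₂ [0:= M ])
    perm  : ∀ {M N₁ N₂ ε} → app (app M (case N₁ N₂)) ε ▷ permRed M N₁ N₂ ε
    μβ    : ∀ {M ε} → app (mu M) ε ▷ muRed M ε
    ξlam  : ∀ {M M'} → M ▷ M' → lam M ▷ lam M'
    ξappl : ∀ {M M' e} → M ▷ M' → app M e ▷ app M' e
    ξappr : ∀ {M e e'} → e ▷ᴱ e' → app M e ▷ app M e'
    ξpairl : ∀ {M M' N} → M ▷ M' → pair M N ▷ pair M' N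
    ξpairr : ∀ {M N N'} → N ▷ N' → pair M N ▷ pair M N'
    ξω₁   : ∀ {M M'} → M ▷ M' → ω₁ M ▷ ω₁ M'
    ξω₂   : ∀ {M M'} → M ▷ M' → ω₂ M ▷ ω₂ M'
    ξmu   : ∀ {M M'} → M ▷ M' → mu M ▷ mu M'
    ξcapp : ∀ {a M M'} → M ▷ M' → capp a M ▷ capp a M'

  data _▷ᴱ_ : El → El → Set where
    ξtm    : ∀ {M M'} → M ▷ M' → tm M ▷ᴱ tm M'
    ξcasel : ∀ {N₁ N₁' N₂} → N₁ ▷ N₁' → case N₁ N₂ ▷ᴱ case N₁' N₂
    ξcaser : ∀ {N₁ N₂ N₂'} → N₂ ▷ N₂' → case N₁ N₂ ▷ᴱ case N₁ N₂'

_◁_ : Tm → Tm → Set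
N ◁ M = M ▷ N

_◁ᴱ_ : El → El → Set
e' ◁ᴱ e = e ▷ᴱ e'

SN : Tm → Set
SN = Acc _◁_

SNᴱ : El → Set
SNᴱ = Acc _◁ᴱ_

-- Typing.  Γ: types of intuitionistic variables; Δ: for each classical
-- variable a the formula A such that a : ¬A.

data _∋_∶_ : List Form → ℕ → Form → Set where
  here  : ∀ {Γ A} → (A ∷ Γ) ∋ zero ∶ A
  there : ∀ {Γ A B n} → Γ ∋ n ∶ A → (B ∷ Γ) ∋ suc n ∶ A

data _∣_⊢_∶_ (Γ Δ : List Form) : Tm → Form → Set where
  ⊢var  : ∀ {x A} → Γ ∋ x ∶ A → Γ ∣ Δ ⊢ var x ∶ A
  ⊢pair : ∀ {M N A B} → Γ ∣ Δ ⊢ M ∶ A → Γ ∣ Δ ⊢ N ∶ B → Γ ∣ Δ ⊢ pair M N ∶ (A ∧' B)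
  ⊢π₁   : ∀ {M A B} → Γ ∣ Δ ⊢ M ∶ (A ∧' B) → Γ ∣ Δ ⊢ app M π₁ ∶ A
  ⊢π₂   : ∀ {M A B} → Γ ∣ Δ ⊢ M ∶ (A ∧' B) → Γ ∣ Δ ⊢ app M π₂ ∶ B
  ⊢lam  : ∀ {M A B} → (A ∷ Γ) ∣ Δ ⊢ M ∶ B → Γ ∣ Δ ⊢ lam M ∶ (A ⇒ B)
  ⊢app  : ∀ {M N A B} → Γ ∣ Δ ⊢ M ∶ (A ⇒ B) → Γ ∣ Δ ⊢ N ∶ A → Γ ∣ Δ ⊢ app M (tm N) ∶ B
  ⊢ω₁   : ∀ {M A B} → Γ ∣ Δ ⊢ M ∶ A → Γ ∣ Δ ⊢ ω₁ M ∶ (A ∨' B)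
  ⊢ω₂   : ∀ {M A B} → Γ ∣ Δ ⊢ M ∶ B → Γ ∣ Δ ⊢ ω₂ M ∶ (A ∨' B)
  ⊢case : ∀ {M N₁ N₂ A₁ A₂ C} → Γ ∣ Δ ⊢ M ∶ (A₁ ∨' A₂) →
          (A₁ ∷ Γ) ∣ Δ ⊢ N₁ ∶ C → (A₂ ∷ Γ) ∣ Δ ⊢ N₂ ∶ C →
          Γ ∣ Δ ⊢ app M (case N₁ N₂) ∶ C
  ⊢mu   : ∀ {M A} → Γ ∣ (A ∷ Δ) ⊢ M ∶ ⊥' → Γ ∣ Δ ⊢ mu M ∶ A
  ⊢capp : ∀ {a M A} → Δ ∋ a ∶ A → Γ ∣ Δ ⊢ M ∶ A → Γ ∣ Δ ⊢ capp a M ∶ ⊥'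

Typed : Tm → Set
Typed M = Σ (List Form) λ Γ → Σ (List Form) λ Δ → Σ Form λ A → Γ ∣ Δ ⊢ M ∶ A

data Simple : Tm → Set where
  svar  : ∀ {x} → Simple (var x)
  sapp  : ∀ {M e} → Simple (app M e)
  scapp : ∀ {a M} → Simple (capp a M)

apps : Tm → List El → Tm
apps M []       = M
apps M (e ∷ es) = apps (app M e) es

data TmOrProj : El → Set where
  isTm : ∀ {M} → TmOrProj (tm M)
  isπ₁ : TmOrProj π₁
  isπ₂ : TmOrProj π₂

data Nice : List El → Set where
  nil  : Nice []
  one  : ∀ {e} → Nice (e ∷ [])
  cons : ∀ {e f fs} → TmOrProj e → Nice (f ∷ fs) → Nice (e ∷ f ∷ fs)

data Shape : Tm → Set where
  f0var : ∀ x Ts → Nice Ts → Shape (apps (var x) Ts)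
  f0cvar : ∀ a T → Shape (capp a T)
  f1 : ∀ N O Ts → Nice Ts → Shape (apps (app (lam N) (tm O)) Ts)
  f2₁ : ∀ N₁ N₂ Ts → Nice Ts → Shape (apps (app (pair N₁ N₂) π₁) Ts)
  f2₂ : ∀ N₁ N₂ Ts → Nice Ts → Shape (apps (app (pair N₁ N₂) π₂) Ts)
  f3₁ : ∀ N O₁ O₂ → Shape (app (ω₁ N) (case O₁ O₂))
  f3₂ : ∀ N O₁ O₂ → Shape (app (ω₂ N) (case O₁ O₂))
  f4 : ∀ N ε Ts → Nice (ε ∷ Ts) → Shape (apps (app (mu N) ε) Ts)
  f5 : ∀ N O₁ O₂ ε Ts → Nice (ε ∷ Ts) → Shape (apps (app (app N (case O₁ O₂)) ε) Ts)

arg : ∀ {M} → Shape M → List El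
arg (f0var x Ts _)      = Ts
arg (f0cvar a T)        = tm T ∷ []
arg (f1 N O Ts _)       = tm O ∷ []
arg (f2₁ N₁ N₂ Ts _)    = tm N₁ ∷ tm N₂ ∷ []
arg (f2₂ N₁ N₂ Ts _)    = tm N₁ ∷ tm N₂ ∷ []
arg (f3₁ N O₁ O₂)       = tm N ∷ tm O₁ ∷ tm O₂ ∷ []
arg (f3₂ N O₁ O₂)       = tm N ∷ tm O₁ ∷ tm O₂ ∷ []
arg (f4 N ε Ts _)       = ε ∷ []
arg (f5 N O₁ O₂ ε Ts _) = []

-- head reduct; nothing exactly when M has no head redex (case (0))
hred : ∀ {M} → Shape M → Maybe Tm
hred (f0var x Ts _)      = nothing
hred (f0cvar a T)        = nothing
hred (f1 N O Ts _)       = just (apps (N [0:= O ]) Ts)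
hred (f2₁ N₁ N₂ Ts _)    = just (apps N₁ Ts)
hred (f2₂ N₁ N₂ Ts _)    = just (apps N₂ Ts)
hred (f3₁ N O₁ O₂)       = just (O₁ [0:= N ])
hred (f3₂ N O₁ O₂)       = just (O₂ [0:= N ])
hred (f4 N ε Ts _)       = just (apps (muRed N ε) Ts)
hred (f5 N O₁ O₂ ε Ts _) = just (apps (permRed N O₁ O₂ ε) Ts)

{-# OPTIONS --safe #-}

-- Every typed term is strongly normalising, so the right-to-left implications
-- hold trivially; left to right, the arguments and the head reduct are subterms
-- and a reduct.  Strong normalisation is proved by orthogonality: a formula A is
-- interpreted by a set ‖ A ‖ of argument stacks, and a term realises A if it is
-- SN against all of them.  A stack [x₁.N₁,x₂.N₂] S belongs to ‖ A ∨ B ‖ when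
-- Nᵢ[xᵢ:=U] S is SN for all realisers U, with S arbitrary.  This condition is
-- invariant under permutative reductions within the stack, and applying a case to
-- a realiser of A ∨ B needs no expansion lemma for permutations.

module Submission where

open import Defs
open import Data.Empty using (⊥-elim)
open import Data.List using (List; []; _∷_; _++_; map)
open import Data.List.Properties using (map-cong; map-∘)
open import Data.List.Relation.Unary.All using (All; []; _∷_)
open import Data.Maybe using (just; nothing)
open import Data.Nat using (ℕ; zero; suc; _≟_)
open import Data.Product using (_×_; _,_)
open import Function using (id; _∘_; const)
open import Function.Bundles using (_⇔_; mk⇔)
open import Induction.WellFounded using (Acc; acc; module Subrelation)
import Relation.Binary.Construct.On as On
open import Relation.Binary.PropositionalEquality
  using (_≡_; _≢_; _≗_; refl; sym; trans; cong; cong₂; subst; module ≡-Reasoning)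
open import Relation.Nullary using (yes; no)

private variable
  M M' N N₁ N₂ O₁ O₂ U Q X : Tm
  e e' ε : El
  S S' T : List El
  A B : Form
  Γ Δ : List Form
  ρ ρ' ρ'' ν κ κ' κ'' : ℕ → ℕ
  σ σ' σ'' : ℕ → Tm
  θ θ' θ'' : ℕ → List El

-- Simultaneous renaming and substitution

mutual
  -- Both index spaces are renamed at once, so that each fusion law is proved a single time; `renI`
  -- and `renC` are the instances with the identity on the other space.
  ren : (ℕ → ℕ) → (ℕ → ℕ) → Tm → Tm
  ren ρ κ (var x)    = var (ρ x)
  ren ρ κ (lam M)    = lam (ren (ext ρ) κ M)
  ren ρ κ (app M e)  = app (ren ρ κ M) (renE ρ κ e)
  ren ρ κ (pair M N) = pair (ren ρ κ M) (ren ρ κ N)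
  ren ρ κ (ω₁ M)     = ω₁ (ren ρ κ M)
  ren ρ κ (ω₂ M)     = ω₂ (ren ρ κ M)
  ren ρ κ (mu M)     = mu (ren ρ (ext κ) M)
  ren ρ κ (capp a M) = capp (κ a) (ren ρ κ M)

  renE : (ℕ → ℕ) → (ℕ → ℕ) → El → El
  renE ρ κ (tm M)       = tm (ren ρ κ M)
  renE ρ κ π₁           = π₁
  renE ρ κ π₂           = π₂
  renE ρ κ (case N₁ N₂) = case (ren (ext ρ) κ N₁) (ren (ext ρ) κ N₂)

wkI wkC : Tm → Tm
wkI = ren suc id
wkC = ren id suc

wkIE wkCE : El → El
wkIE = renE suc id
wkCE = renE id suc

_∙_ : ∀ {ℓ} {C : Set ℓ} → C → (ℕ → C) → ℕ → C
(c ∙ f) zero    = c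
(c ∙ f) (suc n) = f n

liftI : (ℕ → Tm) → ℕ → Tm
liftI σ = var zero ∙ (wkI ∘ σ)

-- The newly bound name receives no arguments; together with `ext κ` it is left as it is.
liftC : (ℕ → List El) → ℕ → List El
liftC θ = [] ∙ (map wkCE ∘ θ)

-- A classical variable a is sent to the name κ a together with the stack θ a:
-- (a M) becomes (κ a (M θ a)).
mutual
  sub : (ℕ → Tm) → (ℕ → ℕ) → (ℕ → List El) → Tm → Tm
  sub σ κ θ (var x)    = σ x
  sub σ κ θ (lam M)    = lam (sub (liftI σ) κ (map wkIE ∘ θ) M)
  sub σ κ θ (app M e)  = app (sub σ κ θ M) (subE σ κ θ e)
  sub σ κ θ (pair M N) = pair (sub σ κ θ M) (sub σ κ θ N)
  sub σ κ θ (ω₁ M)     = ω₁ (sub σ κ θ M)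
  sub σ κ θ (ω₂ M)     = ω₂ (sub σ κ θ M)
  sub σ κ θ (mu M)     = mu (sub (wkC ∘ σ) (ext κ) (liftC θ) M)
  sub σ κ θ (capp a M) = capp (κ a) (apps (sub σ κ θ M) (θ a))

  subE : (ℕ → Tm) → (ℕ → ℕ) → (ℕ → List El) → El → El
  subE σ κ θ (tm M)       = tm (sub σ κ θ M)
  subE σ κ θ π₁           = π₁
  subE σ κ θ π₂           = π₂
  subE σ κ θ (case N₁ N₂) = case (sub (liftI σ) κ (map wkIE ∘ θ) N₁)
                                 (sub (liftI σ) κ (map wkIE ∘ θ) N₂)

noStack : ℕ → List El
noStack = const []

apps-++ : ∀ S → apps M (S ++ T) ≡ apps (apps M S) T
apps-++ []      = refl
apps-++ (e ∷ S) = apps-++ S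

ren-apps : ∀ ρ κ S → ren ρ κ (apps M S) ≡ apps (ren ρ κ M) (map (renE ρ κ) S)
ren-apps ρ κ []      = refl
ren-apps ρ κ (e ∷ S) = ren-apps ρ κ S

sub-apps : ∀ σ κ θ S → sub σ κ θ (apps M S) ≡ apps (sub σ κ θ M) (map (subE σ κ θ) S)
sub-apps σ κ θ []      = refl
sub-apps σ κ θ (e ∷ S) = sub-apps σ κ θ S

-- Fusion laws.  They are stated relative to pointwise equal composites, since
-- function extensionality is not available.

ext-id : ρ ≗ id → ext ρ ≗ id
ext-id h zero    = refl
ext-id h (suc n) = cong suc (h n)

ext-∘ : ρ' ∘ ρ ≗ ρ'' → ext ρ' ∘ ext ρ ≗ ext ρ''
ext-∘ h zero    = refl
ext-∘ h (suc n) = cong suc (h n)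

mutual
  ren-ren : ρ' ∘ ρ ≗ ρ'' → κ' ∘ κ ≗ κ'' →
            ren ρ' κ' ∘ ren ρ κ ≗ ren ρ'' κ''
  ren-ren h k (var x)    = cong var (h x)
  ren-ren h k (lam M)    = cong lam (ren-ren (ext-∘ h) k M)
  ren-ren h k (app M e)  = cong₂ app (ren-ren h k M) (renE-renE h k e)
  ren-ren h k (pair M N) = cong₂ pair (ren-ren h k M) (ren-ren h k N)
  ren-ren h k (ω₁ M)     = cong ω₁ (ren-ren h k M)
  ren-ren h k (ω₂ M)     = cong ω₂ (ren-ren h k M)
  ren-ren h k (mu M)     = cong mu (ren-ren h (ext-∘ k) M)
  ren-ren h k (capp a M) = cong₂ capp (k a) (ren-ren h k M)

  renE-renE : ρ' ∘ ρ ≗ ρ'' → κ' ∘ κ ≗ κ'' →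
              renE ρ' κ' ∘ renE ρ κ ≗ renE ρ'' κ''
  renE-renE h k (tm M)       = cong tm (ren-ren h k M)
  renE-renE h k π₁           = refl
  renE-renE h k π₂           = refl
  renE-renE h k (case N₁ N₂) = cong₂ case (ren-ren (ext-∘ h) k N₁) (ren-ren (ext-∘ h) k N₂)

ren-wkI : ∀ ρ κ M → ren (ext ρ) κ (wkI M) ≡ wkI (ren ρ κ M)
ren-wkI ρ κ M = trans (ren-ren (λ _ → refl) (λ _ → refl) M)
                      (sym (ren-ren (λ _ → refl) (λ _ → refl) M))

renE-wkIE : ∀ ρ κ e → renE (ext ρ) κ (wkIE e) ≡ wkIE (renE ρ κ e)
renE-wkIE ρ κ e = trans (renE-renE (λ _ → refl) (λ _ → refl) e)
                        (sym (renE-renE (λ _ → refl) (λ _ → refl) e))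

ren-wkC : ∀ ρ κ M → ren ρ (ext κ) (wkC M) ≡ wkC (ren ρ κ M)
ren-wkC ρ κ M = trans (ren-ren (λ _ → refl) (λ _ → refl) M)
                      (sym (ren-ren (λ _ → refl) (λ _ → refl) M))

renE-wkCE : ∀ ρ κ e → renE ρ (ext κ) (wkCE e) ≡ wkCE (renE ρ κ e)
renE-wkCE ρ κ e = trans (renE-renE (λ _ → refl) (λ _ → refl) e)
                        (sym (renE-renE (λ _ → refl) (λ _ → refl) e))

map-square : ∀ {f g f' g' : El → El} → (∀ e → f (g e) ≡ g' (f' e)) →
             ∀ S → map f (map g S) ≡ map g' (map f' S)
map-square h S = trans (sym (map-∘ S)) (trans (map-cong h S) (map-∘ S))

liftI-∘ext : σ ∘ ρ ≗ σ' → liftI σ ∘ ext ρ ≗ liftI σ'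
liftI-∘ext h zero    = refl
liftI-∘ext h (suc x) = cong wkI (h x)

liftC-∘ext : θ ∘ κ ≗ θ' → liftC θ ∘ ext κ ≗ liftC θ'
liftC-∘ext h zero    = refl
liftC-∘ext h (suc a) = cong (map wkCE) (h a)

mutual
  sub-ren : σ ∘ ρ ≗ σ' → κ ∘ ν ≗ κ' → θ ∘ ν ≗ θ' →
            sub σ κ θ ∘ ren ρ ν ≗ sub σ' κ' θ'
  sub-ren h k t (var x)    = h x
  sub-ren h k t (lam M)    = cong lam (sub-ren (liftI-∘ext h) k (cong (map wkIE) ∘ t) M)
  sub-ren h k t (app M e)  = cong₂ app (sub-ren h k t M) (subE-renE h k t e)
  sub-ren h k t (pair M N) = cong₂ pair (sub-ren h k t M) (sub-ren h k t N)
  sub-ren h k t (ω₁ M)     = cong ω₁ (sub-ren h k t M)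
  sub-ren h k t (ω₂ M)     = cong ω₂ (sub-ren h k t M)
  sub-ren h k t (mu M)     = cong mu (sub-ren (cong wkC ∘ h) (ext-∘ k) (liftC-∘ext t) M)
  sub-ren h k t (capp a M) = cong₂ capp (k a) (cong₂ apps (sub-ren h k t M) (t a))

  subE-renE : σ ∘ ρ ≗ σ' → κ ∘ ν ≗ κ' → θ ∘ ν ≗ θ' →
              subE σ κ θ ∘ renE ρ ν ≗ subE σ' κ' θ'
  subE-renE h k t (tm M)       = cong tm (sub-ren h k t M)
  subE-renE h k t π₁           = refl
  subE-renE h k t π₂           = refl
  subE-renE h k t (case N₁ N₂) = cong₂ case (sub-ren (liftI-∘ext h) k (cong (map wkIE) ∘ t) N₁)
                                            (sub-ren (liftI-∘ext h) k (cong (map wkIE) ∘ t) N₂)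

module _ {ρ ν : ℕ → ℕ} where
  ren-liftI : ren ρ ν ∘ σ ≗ σ' → ren (ext ρ) ν ∘ liftI σ ≗ liftI σ'
  ren-liftI h zero            = refl
  ren-liftI {σ = σ} h (suc x) = trans (ren-wkI ρ ν (σ x)) (cong wkI (h x))

  ren-wkCσ : ren ρ ν ∘ σ ≗ σ' → ren ρ (ext ν) ∘ wkC ∘ σ ≗ wkC ∘ σ'
  ren-wkCσ {σ = σ} h x = trans (ren-wkC ρ ν (σ x)) (cong wkC (h x))

  ren-wkIθ : map (renE ρ ν) ∘ θ ≗ θ' →
             map (renE (ext ρ) ν) ∘ map wkIE ∘ θ ≗ map wkIE ∘ θ'
  ren-wkIθ {θ = θ} t a = trans (map-square (renE-wkIE ρ ν) (θ a)) (cong (map wkIE) (t a))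

  ren-liftC : map (renE ρ ν) ∘ θ ≗ θ' →
              map (renE ρ (ext ν)) ∘ liftC θ ≗ liftC θ'
  ren-liftC t zero            = refl
  ren-liftC {θ = θ} t (suc a) = trans (map-square (renE-wkCE ρ ν) (θ a)) (cong (map wkCE) (t a))

mutual
  ren-sub : ren ρ ν ∘ σ ≗ σ' → ν ∘ κ ≗ κ' → map (renE ρ ν) ∘ θ ≗ θ' →
            ren ρ ν ∘ sub σ κ θ ≗ sub σ' κ' θ'
  ren-sub h k t (var x)    = h x
  ren-sub h k t (lam M)    = cong lam (ren-sub (ren-liftI h) k (ren-wkIθ t) M)
  ren-sub h k t (app M e)  = cong₂ app (ren-sub h k t M) (renE-subE h k t e)
  ren-sub h k t (pair M N) = cong₂ pair (ren-sub h k t M) (ren-sub h k t N)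
  ren-sub h k t (ω₁ M)     = cong ω₁ (ren-sub h k t M)
  ren-sub h k t (ω₂ M)     = cong ω₂ (ren-sub h k t M)
  ren-sub h k t (mu M)     = cong mu (ren-sub (ren-wkCσ h) (ext-∘ k) (ren-liftC t) M)
  ren-sub {ρ = ρ} {ν = ν} {θ = θ} h k t (capp a M) =
    cong₂ capp (k a) (trans (ren-apps ρ ν (θ a)) (cong₂ apps (ren-sub h k t M) (t a)))

  renE-subE : ren ρ ν ∘ σ ≗ σ' → ν ∘ κ ≗ κ' → map (renE ρ ν) ∘ θ ≗ θ' →
              renE ρ ν ∘ subE σ κ θ ≗ subE σ' κ' θ'
  renE-subE h k t (tm M)       = cong tm (ren-sub h k t M)
  renE-subE h k t π₁           = refl
  renE-subE h k t π₂           = refl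
  renE-subE h k t (case N₁ N₂) = cong₂ case (ren-sub (ren-liftI h) k (ren-wkIθ t) N₁)
                                            (ren-sub (ren-liftI h) k (ren-wkIθ t) N₂)

module _ (σ : ℕ → Tm) (κ : ℕ → ℕ) (θ : ℕ → List El) where
  sub-wkI : ∀ M → sub (liftI σ) κ (map wkIE ∘ θ) (wkI M) ≡ wkI (sub σ κ θ M)
  sub-wkI M = trans (sub-ren (λ _ → refl) (λ _ → refl) (λ _ → refl) M)
                    (sym (ren-sub (λ _ → refl) (λ _ → refl) (λ _ → refl) M))

  subE-wkIE : ∀ e → subE (liftI σ) κ (map wkIE ∘ θ) (wkIE e) ≡ wkIE (subE σ κ θ e)
  subE-wkIE e = trans (subE-renE (λ _ → refl) (λ _ → refl) (λ _ → refl) e)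
                      (sym (renE-subE (λ _ → refl) (λ _ → refl) (λ _ → refl) e))

  sub-wkC : ∀ M → sub (wkC ∘ σ) (ext κ) (liftC θ) (wkC M) ≡ wkC (sub σ κ θ M)
  sub-wkC M = trans (sub-ren (λ _ → refl) (λ _ → refl) (λ _ → refl) M)
                    (sym (ren-sub (λ _ → refl) (λ _ → refl) (λ _ → refl) M))

  subE-wkCE : ∀ e → subE (wkC ∘ σ) (ext κ) (liftC θ) (wkCE e) ≡ wkCE (subE σ κ θ e)
  subE-wkCE e = trans (subE-renE (λ _ → refl) (λ _ → refl) (λ _ → refl) e)
                      (sym (renE-subE (λ _ → refl) (λ _ → refl) (λ _ → refl) e))

map-square-++ : ∀ {f g f' g' : El → El} → (∀ e → f (g e) ≡ g' (f' e)) →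
                ∀ S T → map f (map g S) ++ map g' T ≡ map g' (map f' S ++ T)
map-square-++ h []      T = refl
map-square-++ h (e ∷ S) T = cong₂ _∷_ (h e) (map-square-++ h S T)

module _ {σ' : ℕ → Tm} {κ' : ℕ → ℕ} {θ' : ℕ → List El} where
  sub-liftI : sub σ' κ' θ' ∘ σ ≗ σ'' →
              sub (liftI σ') κ' (map wkIE ∘ θ') ∘ liftI σ ≗ liftI σ''
  sub-liftI h zero            = refl
  sub-liftI {σ = σ} h (suc x) = trans (sub-wkI σ' κ' θ' (σ x)) (cong wkI (h x))

  sub-wkCσ : sub σ' κ' θ' ∘ σ ≗ σ'' →
             sub (wkC ∘ σ') (ext κ') (liftC θ') ∘ wkC ∘ σ ≗ wkC ∘ σ''
  sub-wkCσ {σ = σ} h x = trans (sub-wkC σ' κ' θ' (σ x)) (cong wkC (h x))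

  sub-wkIθ : (∀ a → map (subE σ' κ' θ') (θ a) ++ θ' (κ a) ≡ θ'' a) →
             ∀ a → map (subE (liftI σ') κ' (map wkIE ∘ θ')) (map wkIE (θ a)) ++ map wkIE (θ' (κ a))
                   ≡ map wkIE (θ'' a)
  sub-wkIθ {θ = θ} {κ = κ} t a =
    trans (map-square-++ (subE-wkIE σ' κ' θ') (θ a) (θ' (κ a))) (cong (map wkIE) (t a))

  sub-liftC : (∀ a → map (subE σ' κ' θ') (θ a) ++ θ' (κ a) ≡ θ'' a) →
              ∀ a → map (subE (wkC ∘ σ') (ext κ') (liftC θ')) (liftC θ a) ++ liftC θ' (ext κ a)
                    ≡ liftC θ'' a
  sub-liftC t zero = refl
  sub-liftC {θ = θ} {κ = κ} t (suc a) =
    trans (map-square-++ (subE-wkCE σ' κ' θ') (θ a) (θ' (κ a))) (cong (map wkCE) (t a))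

mutual
  -- In the third premise the stack of `a` is first substituted into and then extended by the stack
  -- of `κ a`: the inner substitution turns `(a M)` into `(κ a (M θ a))`, and the outer one acts on
  -- the name `κ a` as well.
  sub-sub : sub σ' κ' θ' ∘ σ ≗ σ'' → κ' ∘ κ ≗ κ'' →
            (∀ a → map (subE σ' κ' θ') (θ a) ++ θ' (κ a) ≡ θ'' a) →
            sub σ' κ' θ' ∘ sub σ κ θ ≗ sub σ'' κ'' θ''
  sub-sub h k t (var x)    = h x
  sub-sub {κ = κ} {θ = θ} h k t (lam M) =
    cong lam (sub-sub (sub-liftI h) k (sub-wkIθ {θ = θ} {κ = κ} t) M)
  sub-sub h k t (app M e)  = cong₂ app (sub-sub h k t M) (subE-subE h k t e)
  sub-sub h k t (pair M N) = cong₂ pair (sub-sub h k t M) (sub-sub h k t N)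
  sub-sub h k t (ω₁ M)     = cong ω₁ (sub-sub h k t M)
  sub-sub h k t (ω₂ M)     = cong ω₂ (sub-sub h k t M)
  sub-sub {σ = σ} h k t (mu M) =
    cong mu (sub-sub (sub-wkCσ {σ = σ} h) (ext-∘ k) (sub-liftC t) M)
  sub-sub {σ' = σ'} {κ' = κ'} {θ' = θ'} {σ = σ} {σ'' = σ''} {κ = κ} {κ'' = κ''} {θ = θ} {θ'' = θ''}
          h k t (capp a M) = cong₂ capp (k a) (begin
    apps (sub σ' κ' θ' (apps (sub σ κ θ M) (θ a))) (θ' (κ a))
      ≡⟨ cong (λ L → apps L (θ' (κ a))) (sub-apps σ' κ' θ' (θ a)) ⟩
    apps (apps (sub σ' κ' θ' (sub σ κ θ M)) (map (subE σ' κ' θ') (θ a))) (θ' (κ a))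
      ≡⟨ apps-++ (map (subE σ' κ' θ') (θ a)) ⟨
    apps (sub σ' κ' θ' (sub σ κ θ M)) (map (subE σ' κ' θ') (θ a) ++ θ' (κ a))
      ≡⟨ cong₂ apps (sub-sub h k t M) (t a) ⟩
    apps (sub σ'' κ'' θ'' M) (θ'' a) ∎)
    where open ≡-Reasoning

  subE-subE : sub σ' κ' θ' ∘ σ ≗ σ'' → κ' ∘ κ ≗ κ'' →
              (∀ a → map (subE σ' κ' θ') (θ a) ++ θ' (κ a) ≡ θ'' a) →
              subE σ' κ' θ' ∘ subE σ κ θ ≗ subE σ'' κ'' θ''
  subE-subE h k t (tm M)       = cong tm (sub-sub h k t M)
  subE-subE h k t π₁           = refl
  subE-subE h k t π₂           = refl
  subE-subE {κ = κ} {θ = θ} h k t (case N₁ N₂) =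
    cong₂ case (sub-sub (sub-liftI h) k (sub-wkIθ {θ = θ} {κ = κ} t) N₁)
               (sub-sub (sub-liftI h) k (sub-wkIθ {θ = θ} {κ = κ} t) N₂)

liftI-var : σ ≗ var → liftI σ ≗ var
liftI-var h zero    = refl
liftI-var h (suc x) = cong wkI (h x)

liftC-[] : θ ≗ noStack → liftC θ ≗ noStack
liftC-[] t zero    = refl
liftC-[] t (suc a) = cong (map wkCE) (t a)

mutual
  sub-id : σ ≗ var → κ ≗ id → θ ≗ noStack → sub σ κ θ ≗ id
  sub-id h k t (var x)    = h x
  sub-id h k t (lam M)    = cong lam (sub-id (liftI-var h) k (cong (map wkIE) ∘ t) M)
  sub-id h k t (app M e)  = cong₂ app (sub-id h k t M) (subE-id h k t e)
  sub-id h k t (pair M N) = cong₂ pair (sub-id h k t M) (sub-id h k t N)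
  sub-id h k t (ω₁ M)     = cong ω₁ (sub-id h k t M)
  sub-id h k t (ω₂ M)     = cong ω₂ (sub-id h k t M)
  sub-id h k t (mu M)     = cong mu (sub-id (cong wkC ∘ h) (ext-id k) (liftC-[] t) M)
  sub-id h k t (capp a M) = cong₂ capp (k a) (cong₂ apps (sub-id h k t M) (t a))

  subE-id : σ ≗ var → κ ≗ id → θ ≗ noStack → subE σ κ θ ≗ id
  subE-id h k t (tm M)       = cong tm (sub-id h k t M)
  subE-id h k t π₁           = refl
  subE-id h k t π₂           = refl
  subE-id h k t (case N₁ N₂) = cong₂ case (sub-id (liftI-var h) k (cong (map wkIE) ∘ t) N₁)
                                          (sub-id (liftI-var h) k (cong (map wkIE) ∘ t) N₂)

-- The renamings and substitutions of Defs as instances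

mutual
  renI≗ren : κ ≗ id → renI ρ ≗ ren ρ κ
  renI≗ren k (var x)    = refl
  renI≗ren k (lam M)    = cong lam (renI≗ren k M)
  renI≗ren k (app M e)  = cong₂ app (renI≗ren k M) (renIE≗renE k e)
  renI≗ren k (pair M N) = cong₂ pair (renI≗ren k M) (renI≗ren k N)
  renI≗ren k (ω₁ M)     = cong ω₁ (renI≗ren k M)
  renI≗ren k (ω₂ M)     = cong ω₂ (renI≗ren k M)
  renI≗ren k (mu M)     = cong mu (renI≗ren (ext-id k) M)
  renI≗ren k (capp a M) = cong₂ capp (sym (k a)) (renI≗ren k M)

  renIE≗renE : κ ≗ id → renIE ρ ≗ renE ρ κ
  renIE≗renE k (tm M)       = cong tm (renI≗ren k M)
  renIE≗renE k π₁           = refl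
  renIE≗renE k π₂           = refl
  renIE≗renE k (case N₁ N₂) = cong₂ case (renI≗ren k N₁) (renI≗ren k N₂)

mutual
  renC≗ren : ρ ≗ id → renC κ ≗ ren ρ κ
  renC≗ren h (var x)    = cong var (sym (h x))
  renC≗ren h (lam M)    = cong lam (renC≗ren (ext-id h) M)
  renC≗ren h (app M e)  = cong₂ app (renC≗ren h M) (renCE≗renE h e)
  renC≗ren h (pair M N) = cong₂ pair (renC≗ren h M) (renC≗ren h N)
  renC≗ren h (ω₁ M)     = cong ω₁ (renC≗ren h M)
  renC≗ren h (ω₂ M)     = cong ω₂ (renC≗ren h M)
  renC≗ren h (mu M)     = cong mu (renC≗ren h M)
  renC≗ren h (capp a M) = cong (capp _) (renC≗ren h M)

  renCE≗renE : ρ ≗ id → renCE κ ≗ renE ρ κ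
  renCE≗renE h (tm M)       = cong tm (renC≗ren h M)
  renCE≗renE h π₁           = refl
  renCE≗renE h π₂           = refl
  renCE≗renE h (case N₁ N₂) = cong₂ case (renC≗ren (ext-id h) N₁) (renC≗ren (ext-id h) N₂)

renIsuc : renIE suc ≗ wkIE
renIsuc = renIE≗renE (λ _ → refl)

renCsuc : renCE suc ≗ wkCE
renCsuc = renCE≗renE (λ _ → refl)

extsI≗liftI : σ ≗ σ' → extsI σ ≗ liftI σ'
extsI≗liftI h zero    = refl
extsI≗liftI h (suc x) = trans (renI≗ren (λ _ → refl) _) (cong wkI (h x))

extsC≗wkC : σ ≗ σ' → extsC σ ≗ wkC ∘ σ'
extsC≗wkC h x = trans (renC≗ren (λ _ → refl) _) (cong wkC (h x))

mutual
  subI≗sub : σ ≗ σ' → κ ≗ id → θ ≗ noStack → subI σ ≗ sub σ' κ θ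
  subI≗sub h k t (var x)    = h x
  subI≗sub h k t (lam M)    = cong lam (subI≗sub (extsI≗liftI h) k (cong (map wkIE) ∘ t) M)
  subI≗sub h k t (app M e)  = cong₂ app (subI≗sub h k t M) (subIE≗subE h k t e)
  subI≗sub h k t (pair M N) = cong₂ pair (subI≗sub h k t M) (subI≗sub h k t N)
  subI≗sub h k t (ω₁ M)     = cong ω₁ (subI≗sub h k t M)
  subI≗sub h k t (ω₂ M)     = cong ω₂ (subI≗sub h k t M)
  subI≗sub h k t (mu M)     = cong mu (subI≗sub (extsC≗wkC h) (ext-id k) (liftC-[] t) M)
  subI≗sub h k t (capp a M) = cong₂ capp (sym (k a)) (cong₂ apps (subI≗sub h k t M) (sym (t a)))

  subIE≗subE : σ ≗ σ' → κ ≗ id → θ ≗ noStack → subIE σ ≗ subE σ' κ θ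
  subIE≗subE h k t (tm M)       = cong tm (subI≗sub h k t M)
  subIE≗subE h k t π₁           = refl
  subIE≗subE h k t π₂           = refl
  subIE≗subE h k t (case N₁ N₂) =
    cong₂ case (subI≗sub (extsI≗liftI h) k (cong (map wkIE) ∘ t) N₁)
               (subI≗sub (extsI≗liftI h) k (cong (map wkIE) ∘ t) N₂)

-- Describes `a :=* ε` by its values: one element at `a`, nothing elsewhere. This form is stable
-- under both kinds of binder and matches the test `b ≟ a` in `msub`.
record OnlyAt (a : ℕ) (ε : El) (θ : ℕ → List El) : Set where
  field
    at        : θ a ≡ ε ∷ []
    elsewhere : ∀ b → b ≢ a → θ b ≡ []
open OnlyAt

OnlyAt-I : ∀ {a} → OnlyAt a ε θ → OnlyAt a (renIE suc ε) (map wkIE ∘ θ)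
OnlyAt-I {ε} t .at = trans (cong (map wkIE) (t .at)) (cong (_∷ []) (sym (renIsuc ε)))
OnlyAt-I t .elsewhere b b≢a = cong (map wkIE) (t .elsewhere b b≢a)

OnlyAt-C : ∀ {a} → OnlyAt a ε θ → OnlyAt (suc a) (renCE suc ε) (liftC θ)
OnlyAt-C {ε} t .at = trans (cong (map wkCE) (t .at)) (cong (_∷ []) (sym (renCsuc ε)))
OnlyAt-C t .elsewhere zero    b≢a = refl
OnlyAt-C t .elsewhere (suc b) b≢a = cong (map wkCE) (t .elsewhere b (b≢a ∘ cong suc))

mutual
  msub≗sub : ∀ {a} → σ ≗ var → κ ≗ id → OnlyAt a ε θ → msub a ε ≗ sub σ κ θ
  msub≗sub h k t (var x)    = sym (h x)
  msub≗sub h k t (lam M)    = cong lam (msub≗sub (liftI-var h) k (OnlyAt-I t) M)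
  msub≗sub h k t (app M e)  = cong₂ app (msub≗sub h k t M) (msubE≗subE h k t e)
  msub≗sub h k t (pair M N) = cong₂ pair (msub≗sub h k t M) (msub≗sub h k t N)
  msub≗sub h k t (ω₁ M)     = cong ω₁ (msub≗sub h k t M)
  msub≗sub h k t (ω₂ M)     = cong ω₂ (msub≗sub h k t M)
  msub≗sub h k t (mu M)     = cong mu (msub≗sub (cong wkC ∘ h) (ext-id k) (OnlyAt-C t) M)
  msub≗sub {a = a} h k t (capp b M) with b ≟ a
  ... | yes refl = cong₂ capp (sym (k b)) (cong₂ apps (msub≗sub h k t M) (sym (t .at)))
  ... | no b≢a   = cong₂ capp (sym (k b)) (cong₂ apps (msub≗sub h k t M) (sym (t .elsewhere b b≢a)))

  msubE≗subE : ∀ {a} → σ ≗ var → κ ≗ id → OnlyAt a ε θ → msubE a ε ≗ subE σ κ θ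
  msubE≗subE h k t (tm M)       = cong tm (msub≗sub h k t M)
  msubE≗subE h k t π₁           = refl
  msubE≗subE h k t π₂           = refl
  msubE≗subE h k t (case N₁ N₂) = cong₂ case (msub≗sub (liftI-var h) k (OnlyAt-I t) N₁)
                                             (msub≗sub (liftI-var h) k (OnlyAt-I t) N₂)

[0:=]-sub : ∀ N M → M [0:= N ] ≡ sub (N ∙ var) id noStack M
[0:=]-sub N = subI≗sub single≗ (λ _ → refl) (λ _ → refl)
  where
  single≗ : single N ≗ N ∙ var
  single≗ zero    = refl
  single≗ (suc x) = refl

msub-zero : ∀ ε M → msub zero (renCE suc ε) M ≡ sub var id ((wkCE ε ∷ []) ∙ noStack) M
msub-zero ε = msub≗sub (λ _ → refl) (λ _ → refl) only
  where
  only : OnlyAt zero (renCE suc ε) ((wkCE ε ∷ []) ∙ noStack)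
  only .at = cong (_∷ []) (sym (renCsuc ε))
  only .elsewhere zero    b≢ = ⊥-elim (b≢ refl)
  only .elsewhere (suc b) b≢ = refl

-- Commutation of substitution with the contraction of redexes

sub-wkI-cancel : ∀ N M → sub (N ∙ var) id noStack (wkI M) ≡ M
sub-wkI-cancel N M = trans (sub-ren (λ _ → refl) (λ _ → refl) (λ _ → refl) M)
                           (sub-id (λ _ → refl) (λ _ → refl) (λ _ → refl) M)

subE-wkIE-cancel : ∀ N e → subE (N ∙ var) id noStack (wkIE e) ≡ e
subE-wkIE-cancel N e = trans (subE-renE (λ _ → refl) (λ _ → refl) (λ _ → refl) e)
                             (subE-id (λ _ → refl) (λ _ → refl) (λ _ → refl) e)

-- The shifted `ε` does not contain the branch variable, so instantiation gives `ε` back. Hence a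
-- permutation does not change the instances of the branches against the rest of the stack.
app-ren-[0:=] : ∀ N U ε → app N (renIE suc ε) [0:= U ] ≡ app (N [0:= U ]) ε
app-ren-[0:=] N U ε = trans ([0:=]-sub U (app N (renIE suc ε)))
  (cong₂ app (sym ([0:=]-sub U N))
    (trans (cong (subE _ _ _) (renIsuc ε)) (subE-wkIE-cancel U ε)))

-- The instantiation cancels the weakening of `σ` and `θ` under the binder. This serves both the
-- commutation with redexes and the extension of the environment in `adequacy-[0:=]`.
sub-lift-[0:=] : ∀ σ κ θ M N →
  sub (liftI σ) κ (map wkIE ∘ θ) M [0:= N ] ≡ sub (N ∙ σ) κ θ M
sub-lift-[0:=] σ κ θ M N =
  trans ([0:=]-sub N (sub (liftI σ) κ (map wkIE ∘ θ) M)) (sub-sub σ≗ (λ _ → refl) θ≗ M)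
  where
  σ≗ : sub (N ∙ var) id noStack ∘ liftI σ ≗ N ∙ σ
  σ≗ zero    = refl
  σ≗ (suc x) = sub-wkI-cancel N (σ x)

  cancel : ∀ S → map (subE (N ∙ var) id noStack) (map wkIE S) ++ [] ≡ S
  cancel []      = refl
  cancel (e ∷ S) = cong₂ _∷_ (subE-wkIE-cancel N e) (cancel S)

  θ≗ : ∀ a → map (subE (N ∙ var) id noStack) (map wkIE (θ a)) ++ [] ≡ θ a
  θ≗ a = cancel (θ a)

sub-[0:=] : ∀ σ κ θ M N →
  sub (liftI σ) κ (map wkIE ∘ θ) M [0:= sub σ κ θ N ] ≡ sub σ κ θ (M [0:= N ])
sub-[0:=] σ κ θ M N = begin
  sub (liftI σ) κ (map wkIE ∘ θ) M [0:= sub σ κ θ N ] ≡⟨ sub-lift-[0:=] σ κ θ M (sub σ κ θ N) ⟩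
  sub (sub σ κ θ N ∙ σ) κ θ M                          ≡⟨ sub-sub σ≗ (λ _ → refl) (λ _ → refl) M ⟨
  sub σ κ θ (sub (N ∙ var) id noStack M)               ≡⟨ cong (sub σ κ θ) ([0:=]-sub N M) ⟨
  sub σ κ θ (M [0:= N ])                               ∎
  where
  open ≡-Reasoning

  σ≗ : sub σ κ θ ∘ (N ∙ var) ≗ sub σ κ θ N ∙ σ
  σ≗ zero    = refl
  σ≗ (suc x) = refl

module _ (S : List El) where
  sub-wkC-var : ∀ M → sub var id (S ∙ noStack) (wkC M) ≡ wkC M
  sub-wkC-var M = begin
    sub var id (S ∙ noStack) (wkC M) ≡⟨ sub-ren (λ _ → refl) (λ _ → refl) (λ _ → refl) M ⟩
    sub var suc noStack M            ≡⟨ ren-sub (λ _ → refl) (λ _ → refl) (λ _ → refl) M ⟨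
    wkC (sub var id noStack M)       ≡⟨ cong wkC (sub-id (λ _ → refl) (λ _ → refl) (λ _ → refl) M) ⟩
    wkC M                            ∎
    where open ≡-Reasoning

  subE-wkCE-var : ∀ e → subE var id (S ∙ noStack) (wkCE e) ≡ wkCE e
  subE-wkCE-var e = begin
    subE var id (S ∙ noStack) (wkCE e) ≡⟨ subE-renE (λ _ → refl) (λ _ → refl) (λ _ → refl) e ⟩
    subE var suc noStack e             ≡⟨ renE-subE (λ _ → refl) (λ _ → refl) (λ _ → refl) e ⟨
    wkCE (subE var id noStack e)       ≡⟨ cong wkCE (subE-id (λ _ → refl) (λ _ → refl) (λ _ → refl) e) ⟩
    wkCE e                             ∎
    where open ≡-Reasoning

-- Both sides fuse to the same substitution: the bound name `zero` is sent to the one-element stack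
-- `ε↑`, and every other name to its weakened stack in `θ`.
sub-msub-zero : ∀ σ κ θ M ε →
  msub zero (renCE suc (subE σ κ θ ε)) (sub (wkC ∘ σ) (ext κ) (liftC θ) M)
  ≡ sub (wkC ∘ σ) (ext κ) (liftC θ) (msub zero (renCE suc ε) M)
sub-msub-zero σ κ θ M ε = begin
  msub zero (renCE suc (subE σ κ θ ε)) (sub (wkC ∘ σ) (ext κ) (liftC θ) M)
    ≡⟨ msub-zero (subE σ κ θ ε) (sub (wkC ∘ σ) (ext κ) (liftC θ) M) ⟩
  sub var id (ε↑ ∙ noStack) (sub (wkC ∘ σ) (ext κ) (liftC θ) M)
    ≡⟨ sub-sub (λ x → sub-wkC-var ε↑ (σ x)) (λ _ → refl) θ≗ M ⟩
  sub (wkC ∘ σ) (ext κ) (ε↑ ∙ (map wkCE ∘ θ)) M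
    ≡⟨ sub-sub (λ _ → refl) (λ _ → refl) θ≗' M ⟨
  sub (wkC ∘ σ) (ext κ) (liftC θ) (sub var id ((wkCE ε ∷ []) ∙ noStack) M)
    ≡⟨ cong (sub (wkC ∘ σ) (ext κ) (liftC θ)) (msub-zero ε M) ⟨
  sub (wkC ∘ σ) (ext κ) (liftC θ) (msub zero (renCE suc ε) M) ∎
  where
  open ≡-Reasoning

  ε↑ : List El
  ε↑ = wkCE (subE σ κ θ ε) ∷ []

  fix : ∀ T → map (subE var id (ε↑ ∙ noStack)) (map wkCE T) ++ [] ≡ map wkCE T
  fix []      = refl
  fix (e ∷ T) = cong₂ _∷_ (subE-wkCE-var ε↑ e) (fix T)

  θ≗ : ∀ a → map (subE var id (ε↑ ∙ noStack)) (liftC θ a) ++ (ε↑ ∙ noStack) (ext κ a)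
             ≡ (ε↑ ∙ (map wkCE ∘ θ)) a
  θ≗ zero    = refl
  θ≗ (suc a) = fix (θ a)

  θ≗' : ∀ a → map (subE (wkC ∘ σ) (ext κ) (liftC θ)) (((wkCE ε ∷ []) ∙ noStack) a) ++ liftC θ a
              ≡ (ε↑ ∙ (map wkCE ∘ θ)) a
  θ≗' zero    = cong (_∷ []) (subE-wkCE σ κ θ ε)
  θ≗' (suc a) = refl

-- Reduction

▷-≡ : M ▷ N → N ≡ M' → M ▷ M'
▷-≡ r refl = r

subE-renIsuc : ∀ σ κ θ ε →
  renIE suc (subE σ κ θ ε) ≡ subE (liftI σ) κ (map wkIE ∘ θ) (renIE suc ε)
subE-renIsuc σ κ θ ε = begin
  renIE suc (subE σ κ θ ε)                         ≡⟨ renIsuc (subE σ κ θ ε) ⟩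
  wkIE (subE σ κ θ ε)                              ≡⟨ subE-wkIE σ κ θ ε ⟨
  subE (liftI σ) κ (map wkIE ∘ θ) (wkIE ε)         ≡⟨ cong (subE (liftI σ) κ (map wkIE ∘ θ)) (renIsuc ε) ⟨
  subE (liftI σ) κ (map wkIE ∘ θ) (renIE suc ε)    ∎
  where open ≡-Reasoning

apps-▷ : ∀ S → M ▷ M' → apps M S ▷ apps M' S
apps-▷ []      r = r
apps-▷ (e ∷ S) r = apps-▷ S (ξappl r)

mutual
  -- Contractions commute with substitution, so one step becomes exactly one step; under a name `a`
  -- it takes place at the head of the stack `θ a`. Through `reflect`, strong normalisation passes
  -- from an instance back to the original term.
  sub-▷ : ∀ σ κ θ → M ▷ M' → sub σ κ θ M ▷ sub σ κ θ M'
  sub-▷ σ κ θ (β {M} {N}) = ▷-≡ β (sub-[0:=] σ κ θ M N)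
  sub-▷ σ κ θ π₁β = π₁β
  sub-▷ σ κ θ π₂β = π₂β
  sub-▷ σ κ θ (ω₁β {M} {N₁}) = ▷-≡ ω₁β (sub-[0:=] σ κ θ N₁ M)
  sub-▷ σ κ θ (ω₂β {M} {N₂ = N₂}) = ▷-≡ ω₂β (sub-[0:=] σ κ θ N₂ M)
  sub-▷ σ κ θ (perm {ε = ε}) =
    ▷-≡ perm (cong (λ f → app _ (case (app _ f) (app _ f))) (subE-renIsuc σ κ θ ε))
  sub-▷ σ κ θ (μβ {M} {ε}) = ▷-≡ μβ (cong mu (sub-msub-zero σ κ θ M ε))
  sub-▷ σ κ θ (ξlam r)   = ξlam (sub-▷ _ _ _ r)
  sub-▷ σ κ θ (ξappl r)  = ξappl (sub-▷ σ κ θ r)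
  sub-▷ σ κ θ (ξappr r)  = ξappr (subE-▷ σ κ θ r)
  sub-▷ σ κ θ (ξpairl r) = ξpairl (sub-▷ σ κ θ r)
  sub-▷ σ κ θ (ξpairr r) = ξpairr (sub-▷ σ κ θ r)
  sub-▷ σ κ θ (ξω₁ r)    = ξω₁ (sub-▷ σ κ θ r)
  sub-▷ σ κ θ (ξω₂ r)    = ξω₂ (sub-▷ σ κ θ r)
  sub-▷ σ κ θ (ξmu r)    = ξmu (sub-▷ _ _ _ r)
  sub-▷ σ κ θ (ξcapp {a} r) = ξcapp (apps-▷ (θ a) (sub-▷ σ κ θ r))

  subE-▷ : ∀ σ κ θ → e ▷ᴱ e' → subE σ κ θ e ▷ᴱ subE σ κ θ e'
  subE-▷ σ κ θ (ξtm r)    = ξtm (sub-▷ σ κ θ r)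
  subE-▷ σ κ θ (ξcasel r) = ξcasel (sub-▷ _ _ _ r)
  subE-▷ σ κ θ (ξcaser r) = ξcaser (sub-▷ _ _ _ r)

[0:=]-▷ : ∀ N → M ▷ M' → (M [0:= N ]) ▷ (M' [0:= N ])
[0:=]-▷ {M} {M'} N r rewrite [0:=]-sub N M | [0:=]-sub N M' = sub-▷ _ _ _ r

-- Reducts of a term applied to a stack

-- A permutation of a case with the next element counts as a reduction of the stack, since it is
-- possible whatever term the stack is applied to.
data _▷ˢ_ : List El → List El → Set where
  here  : e ▷ᴱ e' → (e ∷ S) ▷ˢ (e' ∷ S)
  there : S ▷ˢ S' → (e ∷ S) ▷ˢ (e ∷ S')
  permˢ : (case O₁ O₂ ∷ ε ∷ S) ▷ˢ (case (app O₁ (renIE suc ε)) (app O₂ (renIE suc ε)) ∷ S)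

_◁ˢ_ : List El → List El → Set
S' ◁ˢ S = S ▷ˢ S'

SNˢ : List El → Set
SNˢ = Acc _◁ˢ_

apps-▷ˢ : ∀ M → S ▷ˢ S' → apps M S ▷ apps M S'
apps-▷ˢ M (here {S = S} r)  = apps-▷ S (ξappr r)
apps-▷ˢ M (there r)         = apps-▷ˢ _ r
apps-▷ˢ M (permˢ {S = S})   = apps-▷ S perm

data Root : Tm → El → Tm → Set where
  β    : Root (lam M) (tm N) (M [0:= N ])
  π₁β  : Root (pair N₁ N₂) π₁ N₁
  π₂β  : Root (pair N₁ N₂) π₂ N₂
  ω₁β  : Root (ω₁ M) (case N₁ N₂) (N₁ [0:= M ])
  ω₂β  : Root (ω₂ M) (case N₁ N₂) (N₂ [0:= M ])
  perm : Root (app M (case N₁ N₂)) ε (permRed M N₁ N₂ ε)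
  μβ   : Root (mu M) ε (muRed M ε)

data Reduct (M : Tm) : List El → Tm → Set where
  head  : M ▷ M' → Reduct M S (apps M' S)
  stack : S ▷ˢ S' → Reduct M S (apps M S')
  root  : Root M e M' → Reduct M (e ∷ S) (apps M' S)

app-reduct : app M e ▷ M' → Reduct M (e ∷ S) (apps M' S)
app-reduct β         = root β
app-reduct π₁β       = root π₁β
app-reduct π₂β       = root π₂β
app-reduct ω₁β       = root ω₁β
app-reduct ω₂β       = root ω₂β
app-reduct perm      = root perm
app-reduct μβ        = root μβ
app-reduct (ξappl r) = head r
app-reduct (ξappr r) = stack (here r)

-- Induction on the stack, with `e` absorbed into the head: a step of the head `app M e` is then
-- split into its possible origins by `app-reduct`.
reduct : ∀ S → apps M S ▷ X → Reduct M S X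
reduct []      r = head r
reduct (e ∷ S) r with reduct S r
... | head s    = app-reduct s
... | stack s   = stack (there s)
-- The head `app M e` is an application, so `perm` is the only root rule that fits; it forces `e` to
-- be a case and so lies within `e ∷ S`.
... | root perm = stack permˢ

-- Strong normalisation against a set of stacks

-- Applied with `f` a one-hole context or an instantiation, to pass from the strong normalisation of
-- a compound to that of its part.
reflect : ∀ {C D : Set} {_<₁_ : C → C → Set} {_<₂_ : D → D → Set} (f : C → D) →
          (∀ {x y} → x <₁ y → f x <₂ f y) → ∀ {x} → Acc _<₂_ (f x) → Acc _<₁_ x
reflect f mono a = Subrelation.accessible mono (On.accessible f a)

SN-▷ : SN M → M ▷ M' → SN M'
SN-▷ (acc s) r = s r

SN-head : ∀ S → SN (apps M S) → SN M
SN-head S = reflect (λ M → apps M S) (apps-▷ S)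

SN-app-arg : SN (app M e) → SNᴱ e
SN-app-arg {M} = reflect (app M) ξappr

SNᴱ-tm : SN M → SNᴱ (tm M)
SNᴱ-tm (acc s) = acc λ { (ξtm r) → SNᴱ-tm (s r) }

Stacks : Set₁
Stacks = List El → Set

Closed : Stacks → Set
Closed P = ∀ {S S'} → P S → S ▷ˢ S' → P S'

_ᗮ : Stacks → Tm → Set
(P ᗮ) M = ∀ S → P S → SN (apps M S)

ᗮ-▷ : ∀ {P} → (P ᗮ) M → M ▷ M' → (P ᗮ) M'
ᗮ-▷ m r S s = SN-▷ (m S s) (apps-▷ S r)

SN-var : ∀ {x} → SNˢ S → SN (apps (var x) S)
SN-var {S} {x} (acc s) = acc (step ∘ reduct S)
  where
  step : Reduct (var x) S X → SN X
  step (stack r) = SN-var (s r)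

SN-capp : ∀ {a} → SN M → SN (capp a M)
SN-capp (acc m) = acc λ { (ξcapp r) → SN-capp (m r) }

-- Stacks interpreting formulas

data Nil : Stacks where
  [] : Nil []

data Args (P : Tm → Set) (R : Stacks) : Stacks where
  []  : Args P R []
  _∷_ : P N → R S → Args P R (tm N ∷ S)

data Projs (R₁ R₂ : Stacks) : Stacks where
  []  : Projs R₁ R₂ []
  π₁∷ : R₁ S → Projs R₁ R₂ (π₁ ∷ S)
  π₂∷ : R₂ S → Projs R₁ R₂ (π₂ ∷ S)

-- The common type of the branches does not occur: the rest of the stack is constrained only through
-- the instances. This keeps `‖_‖` structurally recursive.
data Cases (P₁ P₂ : Tm → Set) : Stacks where
  []    : Cases P₁ P₂ []
  case∷ : (∀ {U} → P₁ U → SN (apps (O₁ [0:= U ]) S)) →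
          (∀ {U} → P₂ U → SN (apps (O₂ [0:= U ]) S)) →
          Cases P₁ P₂ (case O₁ O₂ ∷ S)

-- Every clause admits the empty stack, which makes each realiser strongly normalising. For atoms
-- and `⊥'` it is the only stack, so there the realisers are exactly the strongly normalising terms.
‖_‖ : Form → Stacks
‖ atom _ ‖ = Nil
‖ ⊥' ‖     = Nil
‖ A ⇒ B ‖  = Args (‖ A ‖ ᗮ) ‖ B ‖
‖ A ∧' B ‖ = Projs ‖ A ‖ ‖ B ‖
‖ A ∨' B ‖ = Cases (‖ A ‖ ᗮ) (‖ B ‖ ᗮ)

⟦_⟧ : Form → Tm → Set
⟦ A ⟧ = ‖ A ‖ ᗮ

[]∈ : ∀ A → ‖ A ‖ []
[]∈ (atom _)  = []
[]∈ ⊥'        = []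
[]∈ (A ⇒ B)   = []
[]∈ (A ∧' B)  = []
[]∈ (A ∨' B)  = []

⟦⟧-SN : ∀ A → ⟦ A ⟧ M → SN M
⟦⟧-SN A m = m [] ([]∈ A)

Cases-closed : ∀ {P₁ P₂} → Closed (Cases P₁ P₂)
Cases-closed (case∷ {S = S} h₁ h₂) (here (ξcasel r)) =
  case∷ (λ u → SN-▷ (h₁ u) (apps-▷ S ([0:=]-▷ _ r))) h₂
Cases-closed (case∷ {S = S} h₁ h₂) (here (ξcaser r)) =
  case∷ h₁ (λ u → SN-▷ (h₂ u) (apps-▷ S ([0:=]-▷ _ r)))
Cases-closed (case∷ h₁ h₂) (there r) =
  case∷ (λ u → SN-▷ (h₁ u) (apps-▷ˢ _ r)) (λ u → SN-▷ (h₂ u) (apps-▷ˢ _ r))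
Cases-closed (case∷ {O₁ = O₁} {O₂ = O₂} h₁ h₂) (permˢ {ε = ε} {S = S}) =
  case∷ (λ {U} u → subst (λ L → SN (apps L S)) (sym (app-ren-[0:=] O₁ U ε)) (h₁ u))
        (λ {U} u → subst (λ L → SN (apps L S)) (sym (app-ren-[0:=] O₂ U ε)) (h₂ u))

‖‖-closed : ∀ A → Closed ‖ A ‖
‖‖-closed (atom _) [] ()
‖‖-closed ⊥' [] ()
‖‖-closed (A ⇒ B) (n ∷ s) (here (ξtm r)) = ᗮ-▷ n r ∷ s
‖‖-closed (A ⇒ B) (n ∷ s) (there r)      = n ∷ ‖‖-closed B s r
‖‖-closed (A ∧' B) (π₁∷ s) (there r)     = π₁∷ (‖‖-closed A s r)
‖‖-closed (A ∧' B) (π₂∷ s) (there r)     = π₂∷ (‖‖-closed B s r)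
‖‖-closed (A ∨' B) = Cases-closed

SNˢ-[] : SNˢ []
SNˢ-[] = acc λ ()

SNˢ-tm : SN N → SNˢ S → SNˢ (tm N ∷ S)
SNˢ-tm (acc n) (acc s) = acc λ where
  (here (ξtm r)) → SNˢ-tm (n r) (acc s)
  (there r)      → SNˢ-tm (acc n) (s r)

SNˢ-π₁ : SNˢ S → SNˢ (π₁ ∷ S)
SNˢ-π₁ (acc s) = acc λ { (there r) → SNˢ-π₁ (s r) }

SNˢ-π₂ : SNˢ S → SNˢ (π₂ ∷ S)
SNˢ-π₂ (acc s) = acc λ { (there r) → SNˢ-π₂ (s r) }

-- A permutation leaves both instances O₁[U] S and O₂[V] S unchanged but shortens S.
SNˢ-case : ∀ S U {V} → SN (apps (O₁ [0:= U ]) S) → SN (apps (O₂ [0:= V ]) S) →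
           SNˢ (case O₁ O₂ ∷ S)
SNˢ-case S U {V} = go S refl refl
  where
  -- With `L₁` and `L₂` tied to the instances only by equations, a permutation can hand on the same
  -- accessibility proofs; the recursion descends lexicographically in these two proofs and then
  -- `S`.
  go : ∀ {O₁ O₂ L₁ L₂} S → L₁ ≡ apps (O₁ [0:= U ]) S → L₂ ≡ apps (O₂ [0:= V ]) S →
       SN L₁ → SN L₂ → SNˢ (case O₁ O₂ ∷ S)
  step : ∀ {O₁ O₂ L₁ L₂} S → L₁ ≡ apps (O₁ [0:= U ]) S → L₂ ≡ apps (O₂ [0:= V ]) S →
         SN L₁ → SN L₂ → (case O₁ O₂ ∷ S) ▷ˢ T → SNˢ T
  go S p q h₁ h₂ = acc (step S p q h₁ h₂)
  step S refl q (acc h₁) h₂ (here (ξcasel r)) = go S refl q (h₁ (apps-▷ S ([0:=]-▷ U r))) h₂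
  step S p refl h₁ (acc h₂) (here (ξcaser r)) = go S p refl h₁ (h₂ (apps-▷ S ([0:=]-▷ V r)))
  step S refl refl (acc h₁) (acc h₂) (there r) =
    go _ refl refl (h₁ (apps-▷ˢ _ r)) (h₂ (apps-▷ˢ _ r))
  step {O₁ = O₁} {O₂ = O₂} (ε ∷ S) p q h₁ h₂ permˢ =
    go S (trans p (cong (λ L → apps L S) (sym (app-ren-[0:=] O₁ U ε))))
         (trans q (cong (λ L → apps L S) (sym (app-ren-[0:=] O₂ V ε)))) h₁ h₂

‖‖-SNˢ : ∀ A → ‖ A ‖ S → SNˢ S
‖‖-SNˢ (atom _) []        = SNˢ-[]
‖‖-SNˢ ⊥'       []        = SNˢ-[]
‖‖-SNˢ (A ⇒ B)  []        = SNˢ-[]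
‖‖-SNˢ (A ⇒ B)  (n ∷ s)   = SNˢ-tm (⟦⟧-SN A n) (‖‖-SNˢ B s)
‖‖-SNˢ (A ∧' B) []        = SNˢ-[]
‖‖-SNˢ (A ∧' B) (π₁∷ s)   = SNˢ-π₁ (‖‖-SNˢ A s)
‖‖-SNˢ (A ∧' B) (π₂∷ s)   = SNˢ-π₂ (‖‖-SNˢ B s)
‖‖-SNˢ (A ∨' B) []        = SNˢ-[]
‖‖-SNˢ (A ∨' B) (case∷ h₁ h₂) =
  -- The branches need some realiser to be instantiated with. A variable will do, by the induction
  -- hypotheses for `A` and `B`; the index `zero` is arbitrary.
  SNˢ-case _ (var zero) (h₁ (λ _ → SN-var ∘ ‖‖-SNˢ A)) (h₂ {var zero} (λ _ → SN-var ∘ ‖‖-SNˢ B))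

var∈ : ∀ A {x} → ⟦ A ⟧ (var x)
var∈ A _ = SN-var ∘ ‖‖-SNˢ A

-- Introduction forms and μ against their stacks

-- Steps inside `Q` and inside `S` are bounded by the two accessibility proofs, and closedness keeps
-- the reduced stack admissible. The remaining step is the root one, whose reduct is covered by `h`.
-- Pairs and injections follow the same pattern; for an injection the root reduct is exactly what
-- `case∷` controls.
SN-lam : ∀ {P R} → Closed (Args P R) → SN Q → (∀ {N} → P N → (R ᗮ) (Q [0:= N ])) →
         SNˢ S → Args P R S → SN (apps (lam Q) S)
SN-lam {Q} {S} {P} {R} c (acc q) h (acc s) p = acc (step p ∘ reduct S)
  where
  step : Args P R S → Reduct (lam Q) S X → SN X
  step p (head (ξlam r))  = SN-lam c (q r) (λ n → ᗮ-▷ (h n) ([0:=]-▷ _ r)) (acc s) p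
  step p (stack r)        = SN-lam c (acc q) h (s r) (c p r)
  step (n ∷ t) (root β)   = h n _ t

SN-pair : ∀ {R₁ R₂} → Closed (Projs R₁ R₂) → SN N₁ → SN N₂ → (R₁ ᗮ) N₁ → (R₂ ᗮ) N₂ →
          SNˢ S → Projs R₁ R₂ S → SN (apps (pair N₁ N₂) S)
SN-pair {N₁} {N₂} {S} {R₁} {R₂} c (acc n₁) (acc n₂) h₁ h₂ (acc s) p = acc (step p ∘ reduct S)
  where
  step : Projs R₁ R₂ S → Reduct (pair N₁ N₂) S X → SN X
  step p (head (ξpairl r)) = SN-pair c (n₁ r) (acc n₂) (ᗮ-▷ h₁ r) h₂ (acc s) p
  step p (head (ξpairr r)) = SN-pair c (acc n₁) (n₂ r) h₁ (ᗮ-▷ h₂ r) (acc s) p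
  step p (stack r)         = SN-pair c (acc n₁) (acc n₂) h₁ h₂ (s r) (c p r)
  step (π₁∷ t) (root π₁β)  = h₁ _ t
  step (π₂∷ t) (root π₂β)  = h₂ _ t

SN-ω₁ : ∀ {P₁ P₂} → (∀ {U U'} → P₁ U → U ▷ U' → P₁ U') → SN U → P₁ U →
        SNˢ S → Cases P₁ P₂ S → SN (apps (ω₁ U) S)
SN-ω₁ {U} {S} {P₁} {P₂} c (acc u) h (acc s) p = acc (step p ∘ reduct S)
  where
  step : Cases P₁ P₂ S → Reduct (ω₁ U) S X → SN X
  step p (head (ξω₁ r))          = SN-ω₁ c (u r) (c h r) (acc s) p
  step p (stack r)               = SN-ω₁ c (acc u) h (s r) (Cases-closed p r)
  step (case∷ h₁ h₂) (root ω₁β)  = h₁ h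

SN-ω₂ : ∀ {P₁ P₂} → (∀ {U U'} → P₂ U → U ▷ U' → P₂ U') → SN U → P₂ U →
        SNˢ S → Cases P₁ P₂ S → SN (apps (ω₂ U) S)
SN-ω₂ {U} {S} {P₁} {P₂} c (acc u) h (acc s) p = acc (step p ∘ reduct S)
  where
  step : Cases P₁ P₂ S → Reduct (ω₂ U) S X → SN X
  step p (head (ξω₂ r))          = SN-ω₂ c (u r) (c h r) (acc s) p
  step p (stack r)               = SN-ω₂ c (acc u) h (s r) (Cases-closed p r)
  step (case∷ h₁ h₂) (root ω₂β)  = h₂ h

-- The body of a μ with its binder removed and its variable sent to the stack S;
-- the name zero that this stack is sent to is an arbitrary choice.
inst : Tm → List El → Tm
inst Q S = sub var (zero ∙ id) (S ∙ noStack) Q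

inst-wkCE : ∀ S e → subE var (zero ∙ id) (S ∙ noStack) (wkCE e) ≡ e
inst-wkCE S e = trans (subE-renE (λ _ → refl) (λ _ → refl) (λ _ → refl) e)
                      (subE-id (λ _ → refl) (λ _ → refl) (λ _ → refl) e)

-- `msub` puts `e` after each argument of the name and `inst` then puts `S` after `e`. So a `μβ`
-- step only moves `e` from the outer stack to the one stored in the body, and the instance stays
-- the same.
inst-msub : ∀ Q e S → inst (msub zero (renCE suc e) Q) S ≡ inst Q (e ∷ S)
inst-msub Q e S = trans (cong (λ L → inst L S) (msub-zero e Q))
                        (sub-sub (λ _ → refl) (λ _ → refl) θ≗ Q)
  where
  θ≗ : ∀ a → map (subE var (zero ∙ id) (S ∙ noStack)) (((wkCE e ∷ []) ∙ noStack) a)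
               ++ (S ∙ noStack) a ≡ ((e ∷ S) ∙ noStack) a
  θ≗ zero    = cong (_∷ S) (inst-wkCE S e)
  θ≗ (suc a) = refl

inst-▷ : ∀ {Q'} S → Q ▷ Q' → inst Q S ▷ inst Q' S
inst-▷ S = sub-▷ _ _ _

SN-body : ∀ S → SN (inst Q S) → SN Q
SN-body S = reflect (λ Q → inst Q S) (inst-▷ S)

-- The SN term (apps M S) bounds the reductions of the stack S while the μ consumes
-- a prefix of it: apps M (e ∷ S) and apps (app M e) S are the same term.
SN-mu : ∀ {P} M S → Closed P → SN (apps M S) → P S → (∀ {T} → P T → SN (inst Q T)) →
        SN Q → SN (apps (mu Q) S)
SN-mu-step : ∀ {P} M S → Closed P → SN (apps M S) → P S → (∀ {T} → P T → SN (inst Q T)) →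
             SN Q → Reduct (mu Q) S X → SN X
SN-mu M S c s p h q = acc (SN-mu-step M S c s p h q ∘ reduct S)
SN-mu-step M S c s p h (acc q) (head (ξmu r)) =
  SN-mu M S c s p (λ {T} t → SN-▷ (h t) (inst-▷ T r)) (q r)
SN-mu-step M S c (acc s) p h q (stack r) = SN-mu M _ c (s (apps-▷ˢ M r)) (c p r) h q
SN-mu-step {Q = Q} {P = P} M (e ∷ S) c s p h q (root μβ) =
  -- The admissible stacks become the `T` with `e ∷ T` in `P`. The bound `s` is unchanged and `S` is
  -- shorter, so the new body may have a fresh accessibility proof, obtained from its instance at
  -- `S`.
  SN-mu (app M e) S (λ p r → c p (there r)) s p h' (SN-body S (h' p))
  where
  h' : ∀ {T} → P (e ∷ T) → SN (inst (msub zero (renCE suc e) Q) T)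
  h' {T} p = subst SN (sym (inst-msub Q e T)) (h p)

-- Turns the instance of a μ body into a substitution with extended environment `S ∙ θ`, to which
-- the induction hypothesis of `adequacy` applies.
inst-sub : ∀ σ κ θ M S →
  inst (sub (wkC ∘ σ) (ext κ) (liftC θ) M) S ≡ sub σ (zero ∙ κ) (S ∙ θ) M
inst-sub σ κ θ M S = sub-sub σ≗ κ≗ θ≗ M
  where
  σ≗ : sub var (zero ∙ id) (S ∙ noStack) ∘ wkC ∘ σ ≗ σ
  σ≗ x = trans (sub-ren (λ _ → refl) (λ _ → refl) (λ _ → refl) (σ x))
               (sub-id (λ _ → refl) (λ _ → refl) (λ _ → refl) (σ x))

  κ≗ : (zero ∙ id) ∘ ext κ ≗ zero ∙ κ
  κ≗ zero    = refl
  κ≗ (suc a) = refl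

  cancel : ∀ T → map (subE var (zero ∙ id) (S ∙ noStack)) (map wkCE T) ++ [] ≡ T
  cancel []      = refl
  cancel (e ∷ T) = cong₂ _∷_ (inst-wkCE S e) (cancel T)

  θ≗ : ∀ a → map (subE var (zero ∙ id) (S ∙ noStack)) (liftC θ a) ++ (S ∙ noStack) (ext κ a)
             ≡ (S ∙ θ) a
  θ≗ zero    = refl
  θ≗ (suc a) = cancel (θ a)

-- Strong normalisation of typed terms

∙-⊩ : ∀ {ℓ} {C : Set ℓ} {P : Form → C → Set} {c : C} {f : ℕ → C} →
      P A c → (∀ {n B} → Γ ∋ n ∶ B → P B (f n)) →
      ∀ {n B} → (A ∷ Γ) ∋ n ∶ B → P B ((c ∙ f) n)
∙-⊩ p h here      = p
∙-⊩ p h (there i) = h i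

-- Induction on the typing derivation: eliminations push their argument onto the stack,
-- introductions use the lemmas above. A name `a` of type `¬B` is given a stack for `B`, so the
-- argument of `(a M)` is run against that stack. The renaming `κ` is arbitrary because names create
-- no redexes: `capp` reduces only inside its argument.
adequacy : Γ ∣ Δ ⊢ M ∶ A →
           (∀ {x B} → Γ ∋ x ∶ B → ⟦ B ⟧ (σ x)) →
           (∀ {a B} → Δ ∋ a ∶ B → ‖ B ‖ (θ a)) →
           ⟦ A ⟧ (sub σ κ θ M)
adequacy-[0:=] : (A ∷ Γ) ∣ Δ ⊢ M ∶ B →
           (∀ {x B} → Γ ∋ x ∶ B → ⟦ B ⟧ (σ x)) →
           (∀ {a B} → Δ ∋ a ∶ B → ‖ B ‖ (θ a)) →
           ⟦ A ⟧ U → ⟦ B ⟧ (sub (liftI σ) κ (map wkIE ∘ θ) M [0:= U ])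

adequacy (⊢var i) g d = g i
adequacy {A = A} (⊢pair {A = B} {B = C} m n) g d S s =
  SN-pair (‖‖-closed A) (⟦⟧-SN B m∈) (⟦⟧-SN C n∈) m∈ n∈ (‖‖-SNˢ A s) s
  where
  m∈ = adequacy m g d
  n∈ = adequacy n g d
adequacy (⊢π₁ m) g d S s = adequacy m g d (π₁ ∷ S) (π₁∷ s)
adequacy (⊢π₂ m) g d S s = adequacy m g d (π₂ ∷ S) (π₂∷ s)
adequacy {A = A} (⊢lam {A = B} {B = C} m) g d S s =
  SN-lam (‖‖-closed A)
    -- The body is strongly normalising because its instance at a variable is, variables being
    -- realisers of `B`.
    (reflect (_[0:= var zero ]) ([0:=]-▷ (var zero)) (⟦⟧-SN C (m∈ (var∈ B))))
    m∈ (‖‖-SNˢ A s) s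
  where
  m∈ : ∀ {U} → ⟦ B ⟧ U → ⟦ C ⟧ _
  m∈ = adequacy-[0:=] m g d
adequacy (⊢app m n) g d S s = adequacy m g d (tm _ ∷ S) (adequacy n g d ∷ s)
adequacy {A = A} (⊢ω₁ {A = B} m) g d S s =
  SN-ω₁ ᗮ-▷ (⟦⟧-SN B m∈) m∈ (‖‖-SNˢ A s) s
  where m∈ = adequacy m g d
adequacy {A = A} (⊢ω₂ {B = B} m) g d S s =
  SN-ω₂ ᗮ-▷ (⟦⟧-SN B m∈) m∈ (‖‖-SNˢ A s) s
  where m∈ = adequacy m g d
adequacy (⊢case m n₁ n₂) g d S s =
  adequacy m g d (case _ _ ∷ S)
    (case∷ (λ u → adequacy-[0:=] n₁ g d u S s) (λ u → adequacy-[0:=] n₂ g d u S s))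
adequacy {A = A} {σ = σ} {θ = θ} {κ = κ} (⊢mu {M} m) g d S s =
  -- The variable is a mere carrier: applied to `S` it is strongly normalising, which supplies the
  -- bound on the reductions of the stack.
  SN-mu (var zero) S (‖‖-closed A) (var∈ A S s) s h (SN-body S (h s))
  where
  h : ∀ {T} → ‖ A ‖ T → SN (inst (sub (wkC ∘ σ) (ext κ) (liftC θ) M) T)
  -- The body has type `⊥'`, so it is run against the empty stack, with `T` assigned to the bound
  -- name.
  h {T} t = subst SN (sym (inst-sub σ κ θ M T)) (adequacy m g (∙-⊩ {P = ‖_‖} t d) [] [])
adequacy (⊢capp i m) g d [] [] = SN-capp (adequacy m g d _ (d i))

adequacy-[0:=] {M = M} {B = B} {σ = σ} {θ = θ} {κ = κ} m g d u =
  subst ⟦ B ⟧ (sym (sub-lift-[0:=] σ κ θ M _)) (adequacy m (∙-⊩ {P = ⟦_⟧} u g) d)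

-- Adequacy at the identity substitution: each variable realises its own type and each name gets the
-- empty stack.
typed-SN : Typed M → SN M
typed-SN {M} (Γ , Δ , A , m) =
  ⟦⟧-SN A (subst ⟦ A ⟧ (sub-id (λ _ → refl) (λ _ → refl) (λ _ → refl) M)
    (adequacy {θ = noStack} {κ = id} m (λ {x} {B} _ → var∈ B) (λ {a} {B} _ → []∈ B)))

-- Arguments and head reducts of simple terms

SN-args : ∀ S → SN (apps M S) → All SNᴱ S
SN-args []      h = []
SN-args (e ∷ S) h = SN-app-arg (SN-head S h) ∷ SN-args S h

SNᴱ-casel : SNᴱ (case O₁ O₂) → SNᴱ (tm O₁)
SNᴱ-casel {O₂ = O₂} = SNᴱ-tm ∘ reflect (λ O → case O O₂) ξcasel

SNᴱ-caser : SNᴱ (case O₁ O₂) → SNᴱ (tm O₂)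
SNᴱ-caser {O₁ = O₁} = SNᴱ-tm ∘ reflect (case O₁) ξcaser

SN-app-fun : SN (app M e) → SN M
SN-app-fun {e = e} = SN-head (e ∷ [])

SN-arg : (s : Shape M) → SN M → All SNᴱ (arg s)
SN-arg (f0var x Ts _)      h = SN-args Ts h
SN-arg (f0cvar a T)        h = SNᴱ-tm (reflect (capp a) ξcapp h) ∷ []
SN-arg (f1 N O Ts _)       h = SN-app-arg (SN-head Ts h) ∷ []
SN-arg (f2₁ N₁ N₂ Ts _)    h = SNᴱ-tm (reflect (λ N → pair N N₂) ξpairl p)
                             ∷ SNᴱ-tm (reflect (pair N₁) ξpairr p) ∷ []
  where p = SN-app-fun (SN-head Ts h)
SN-arg (f2₂ N₁ N₂ Ts _)    h = SNᴱ-tm (reflect (λ N → pair N N₂) ξpairl p)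
                             ∷ SNᴱ-tm (reflect (pair N₁) ξpairr p) ∷ []
  where p = SN-app-fun (SN-head Ts h)
SN-arg (f3₁ N O₁ O₂)       h = SNᴱ-tm (reflect ω₁ ξω₁ (SN-app-fun h))
                             ∷ SNᴱ-casel (SN-app-arg h) ∷ SNᴱ-caser (SN-app-arg h) ∷ []
SN-arg (f3₂ N O₁ O₂)       h = SNᴱ-tm (reflect ω₂ ξω₂ (SN-app-fun h))
                             ∷ SNᴱ-casel (SN-app-arg h) ∷ SNᴱ-caser (SN-app-arg h) ∷ []
SN-arg (f4 N ε Ts _)       h = SN-app-arg (SN-head Ts h) ∷ []
SN-arg (f5 N O₁ O₂ ε Ts _) h = []

hred-▷ : (s : Shape M) → hred s ≡ just N → M ▷ N
hred-▷ (f1 N O Ts _)       refl = apps-▷ Ts β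
hred-▷ (f2₁ N₁ N₂ Ts _)    refl = apps-▷ Ts π₁β
hred-▷ (f2₂ N₁ N₂ Ts _)    refl = apps-▷ Ts π₂β
hred-▷ (f3₁ N O₁ O₂)       refl = ω₁β
hred-▷ (f3₂ N O₁ O₂)       refl = ω₂β
hred-▷ (f4 N ε Ts _)       refl = apps-▷ Ts μβ
hred-▷ (f5 N O₁ O₂ ε Ts _) refl = apps-▷ Ts perm

theorem3p6 : (M : Tm) → Typed M → Simple M → (s : Shape M) →
    ((N : Tm) → hred s ≡ just N → (SN M ⇔ (All SNᴱ (arg s) × SN N)))
    × (hred s ≡ nothing → (SN M ⇔ All SNᴱ (arg s)))
theorem3p6 M t _ s =
    (λ N eq → mk⇔ (λ m → SN-arg s m , SN-▷ m (hred-▷ s eq)) (const (typed-SN t)))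
  , (λ _ → mk⇔ (SN-arg s) (const (typed-SN t)))
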